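{- Let $M=(S,P,I,AP,L)$ be a finite possibilistic Kripke structure, let $B\subseteq S$ and let $s\in S$. Then $$Po(s\models\square\lozenge B)=\bigvee_{a\in B}\big(P^+(s,a)\wedge P^+(a,a)\big).$$
   Context: For subsets or families in $[0,1]$, $\vee$ denotes supremum and $\wedge$ infimum (with $\bigvee\emptyset=0$). A possibilistic Kripke structure is a tuple $M=(S,P,I,AP,L)$ where $S$ is a countable nonempty set of states; $P:S\times S\to[0,1]$ satisfies $\bigvee_{s'\in S}P(s,s')=1$ for all $s\in S$; $I:S\to[0,1]$ satisfies $\bigvee_{s\in S}I(s)=1$; $AP$ is a set of atomic propositions; and $L:S\to 2^{AP}$ is a labeling function. It is finite if $S$ and $AP$ are finite. A path of $M$ is an infinite sequence $\pi=s_0s_1s_2\cdots\in S^\omega$ with $P(s_i,s_{i+1})>0$ for all $i\ge 0$; $Paths(M)$ is the set of all paths and $Paths(s)$ the set of those with $s_0=s$. Define $Po^M(\pi)=I(s_0)\wedge\bigwedge_{i=0}^\infty P(s_i,s_{i+1})$ for $\pi=s_0s_1\cdots\in Paths(M)$, and $Po^M(E)=\bigvee\{Po^M(\pi)\mid\pi\in E\}$ for $E\subseteq Paths(M)$. For a state $s$, $M_s$ is the structure obtained from $M$ by replacing $I$ with the initial distribution that is $1$ at $s$ and $0$ elsewhere. For a set of paths $E$, $Po(s\models E)=Po^{M_s}(E\cap Paths(s))$. The event $\square\lozenge B$ is the set of all paths that visit $B$ infinitely often. The transitive closure $P^+$ of $P$ is $P^+(s,t)=\bigvee\{P(s_0,s_1)\wedge\cdots\wedge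 P(s_{k-1},s_k)\mid k\ge1,\ s_0=s,\ s_k=t,\ s_1,\dots,s_{k-1}\in S\}$. -}

module Defs where

open import Data.Bool.Base using (if_then_else_)
open import Data.Fin.Base using (Fin)
open import Data.List.Base using (List; []; _∷_)
open import Data.Nat.Base as ℕ using (ℕ; suc)
open import Data.Nat.Properties using (eq?)
open import Data.Product.Base using (Σ; Σ-syntax; ∃-syntax; _×_; _,_)
open import Data.Rational.Base as ℚ using (ℚ; 0ℚ; 1ℚ)
import Data.Rational.Properties as ℚ
open import Data.Sum.Base using (_⊎_; inj₁; inj₂)
open import Function.Bundles using (_↣_; _↔_)
open import Level using (0ℓ)
open import Relation.Binary.PropositionalEquality.Core using (_≡_; refl)
open import Relation.Nullary.Decidable using (does; yes; no; dec-true)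
open import Relation.Unary using (Pred; _∈_; _∉_; _⊆_; _∩_)

-- Real numbers are Dedekind's lower cuts: x is represented by the set
-- { q ∈ ℚ | q < x }.  The last two fields say 0 ≤ x and x ≤ 1.

record [0,1] : Set₁ where
  field
    cut      : Pred ℚ 0ℓ
    downward : ∀ {p q} → p ℚ.< q → q ∈ cut → p ∈ cut
    rounded  : ∀ {p} → p ∈ cut → ∃[ q ] p ℚ.< q × q ∈ cut
    lower    : ∀ {p} → p ℚ.< 0ℚ → p ∈ cut
    upper    : ∀ {p} → p ∈ cut → p ℚ.< 1ℚ

open [0,1] public

infix 4 _≤_ _<_ _≈_

_≤_ : [0,1] → [0,1] → Set
x ≤ y = cut x ⊆ cut y

_<_ : [0,1] → [0,1] → Set
x < y = ∃[ q ] q ∉ cut x × q ∈ cut y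

-- Equality of reals is equality of cuts as sets of rationals.
_≈_ : [0,1] → [0,1] → Set
x ≈ y = x ≤ y × y ≤ x

𝟎 : [0,1]
𝟎 = record
  { cut      = ℚ._< 0ℚ
  ; downward = ℚ.<-trans
  ; rounded  = ℚ.<-dense
  ; lower    = λ p<0 → p<0
  ; upper    = λ p<0 → ℚ.<-trans p<0 (ℚ.positive⁻¹ 1ℚ)
  }

𝟏 : [0,1]
𝟏 = record
  { cut      = ℚ._< 1ℚ
  ; downward = ℚ.<-trans
  ; rounded  = ℚ.<-dense
  ; lower    = λ p<0 → ℚ.<-trans p<0 (ℚ.positive⁻¹ 1ℚ)
  ; upper    = λ p<1 → p<1
  }

infixr 7 _∧_

_∧_ : [0,1] → [0,1] → [0,1]
x ∧ y = record
  { cut      = cut x ∩ cut y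
  ; downward = λ p<q (q∈x , q∈y) → downward x p<q q∈x , downward y p<q q∈y
  ; rounded  = λ (p∈x , p∈y) → meet (rounded x p∈x) (rounded y p∈y)
  ; lower    = λ p<0 → lower x p<0 , lower y p<0
  ; upper    = λ (p∈x , _) → upper x p∈x
  }
  where
  meet : ∀ {p} → ∃[ q ] p ℚ.< q × q ∈ cut x → ∃[ r ] p ℚ.< r × r ∈ cut y →
         ∃[ q ] p ℚ.< q × q ∈ cut x ∩ cut y
  meet (q , p<q , q∈x) (r , p<r , r∈y) with q ℚ.<? r
  ... | yes q<r = q , p<q , q∈x , downward y q<r r∈y
  ... | no  q≮r with ℚ.<-dense p<r
  ...   | t , p<t , t<r =
    t , p<t , downward x (ℚ.<-≤-trans t<r (ℚ.≮⇒≥ q≮r)) q∈x , downward y t<r r∈y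

-- Suprema are taken in [0,1]: the first disjunct makes the empty supremum 𝟎.
⋁ : {J : Set} → (J → [0,1]) → [0,1]
⋁ f = record
  { cut      = λ p → p ℚ.< 0ℚ ⊎ ∃[ j ] p ∈ cut (f j)
  ; downward = λ { p<q (inj₁ q<0)       → inj₁ (ℚ.<-trans p<q q<0)
                 ; p<q (inj₂ (j , q∈f)) → inj₂ (j , downward (f j) p<q q∈f) }
  ; rounded  = λ { (inj₁ p<0)       → let q , p<q , q<0 = ℚ.<-dense p<0 in
                                      q , p<q , inj₁ q<0
                 ; (inj₂ (j , p∈f)) → let q , p<q , q∈f = rounded (f j) p∈f in
                                      q , p<q , inj₂ (j , q∈f) }
  ; lower    = inj₁
  ; upper    = λ { (inj₁ p<0)       → upper 𝟎 p<0
                 ; (inj₂ (j , p∈f)) → upper (f j) p∈f }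
  }

-- An intersection of cuts may have a greatest element, so p < ⋀ f asks for
-- some q > p lying in all the cuts.  The bound q ≤ 1 makes the empty infimum 𝟏.
⋀ : {J : Set} → (J → [0,1]) → [0,1]
⋀ f = record
  { cut      = λ p → ∃[ q ] p ℚ.< q × q ℚ.≤ 1ℚ × (∀ j → q ∈ cut (f j))
  ; downward = λ p<p′ (q , p′<q , rest) → q , ℚ.<-trans p<p′ p′<q , rest
  ; rounded  = λ (q , p<q , rest) → let r , p<r , r<q = ℚ.<-dense p<q in
                                    r , p<r , q , r<q , rest
  ; lower    = λ p<0 → let q , p<q , q<0 = ℚ.<-dense p<0 in
                       q , p<q , ℚ.<⇒≤ (upper 𝟎 q<0) , λ j → lower (f j) q<0
  ; upper    = λ (q , p<q , q≤1 , _) → ℚ.<-≤-trans p<q q≤1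
  }

module _ {J : Set} (f : J → [0,1]) where

  ⋁-upper : ∀ j → f j ≤ ⋁ f
  ⋁-upper j p∈f = inj₂ (j , p∈f)

  ⋁-least : ∀ y → (∀ j → f j ≤ y) → ⋁ f ≤ y
  ⋁-least y f≤y (inj₁ p<0)       = lower y p<0
  ⋁-least y f≤y (inj₂ (j , p∈f)) = f≤y j p∈f

  ⋀-lower : ∀ j → ⋀ f ≤ f j
  ⋀-lower j (q , p<q , _ , q∈f) = downward (f j) p<q (q∈f j)

  ⋀-greatest : ∀ y → (∀ j → y ≤ f j) → y ≤ ⋀ f
  ⋀-greatest y y≤f p∈y = let q , p<q , q∈y = rounded y p∈y in
    q , p<q , ℚ.<⇒≤ (upper y q∈y) , λ j → y≤f j q∈y

record PossibilisticKripkeStructure : Set₁ where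
  field
    S         : Set
    countable : S ↣ ℕ
    nonempty  : S
    P         : S → S → [0,1]
    P-normal  : ∀ s → ⋁ (P s) ≈ 𝟏
    I         : S → [0,1]
    I-normal  : ⋁ I ≈ 𝟏
    AP        : Set
    L         : S → Pred AP 0ℓ

open PossibilisticKripkeStructure public

FiniteSet : Set → Set
FiniteSet A = ∃[ n ] (A ↔ Fin n)

Finite : PossibilisticKripkeStructure → Set
Finite M = FiniteSet (S M) × FiniteSet (AP M)

dirac : (M : PossibilisticKripkeStructure) → S M → S M → [0,1]
dirac M s t = if does (eq? (countable M) s t) then 𝟏 else 𝟎

𝟏≤dirac : ∀ M s → 𝟏 ≤ dirac M s s
𝟏≤dirac M s p<1 rewrite dec-true (eq? (countable M) s s) refl = p<1

dirac-normal : ∀ M s → ⋁ (dirac M s) ≈ 𝟏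
dirac-normal M s = upper (⋁ (dirac M s)) , λ p<1 → inj₂ (s , 𝟏≤dirac M s p<1)

-- M ⟨ s ⟩ is the structure usually written M with subscript s.
_⟨_⟩ : (M : PossibilisticKripkeStructure) → S M → PossibilisticKripkeStructure
M ⟨ s ⟩ = record M { I = dirac M s ; I-normal = dirac-normal M s }

Paths : PossibilisticKripkeStructure → Set
Paths M = Σ[ π ∈ (ℕ → S M) ] (∀ i → 𝟎 < P M (π i) (π (suc i)))

Event : PossibilisticKripkeStructure → Set₁
Event M = Pred (Paths M) 0ℓ

PathsFrom : (M : PossibilisticKripkeStructure) → S M → Event M
PathsFrom M s (π , _) = π 0 ≡ s

PoPath : (M : PossibilisticKripkeStructure) → Paths M → [0,1]
PoPath M (π , _) = I M (π 0) ∧ ⋀ (λ i → P M (π i) (π (suc i)))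

Po : (M : PossibilisticKripkeStructure) → Event M → [0,1]
Po M E = ⋁ {J = Σ (Paths M) E} (λ (π , _) → PoPath M π)

-- M and M ⟨ s ⟩ have the same P, hence definitionally the same paths.
Po[_,_⊨_] : (M : PossibilisticKripkeStructure) → S M → Event M → [0,1]
Po[ M , s ⊨ E ] = Po (M ⟨ s ⟩) (E ∩ PathsFrom M s)

□◇ : (M : PossibilisticKripkeStructure) → Pred (S M) 0ℓ → Event M
□◇ M B (π , _) = ∀ n → ∃[ m ] n ℕ.≤ m × π m ∈ B

-- For us = s₁ ⋯ sₖ₋₁ (k ≥ 1) this is P(s,s₁) ∧ P(s₁,s₂) ∧ ⋯ ∧ P(sₖ₋₁,t).
walk : (M : PossibilisticKripkeStructure) → S M → List (S M) → S M → [0,1]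
walk M s []       t = P M s t
walk M s (u ∷ us) t = P M s u ∧ walk M u us t

P⁺ : (M : PossibilisticKripkeStructure) → S M → S M → [0,1]
P⁺ M s t = ⋁ (λ us → walk M s us t)

{-# OPTIONS --safe #-}

-- If every transition of a path from s has possibility above p and the path
-- visits B infinitely often, then by the pigeonhole principle some a ∈ B occurs
-- twice at positive times, which gives walks s → a and a → a above p.
-- Conversely, such walks unroll to the lasso that runs from s to a and then
-- repeats the closed walk at a forever.
module Submission where

open import Defs
open import Data.Fin.Base using (toℕ)
open import Data.Fin.Properties using (pigeonhole)
open import Data.List.Base using (List; []; _∷_)
open import Data.Nat.Base as ℕ using (ℕ; zero; suc; z<s; s<s)
import Data.Nat.Properties as ℕ
open import Data.Product.Base using (Σ; ∃-syntax; _×_; _,_; proj₁; proj₂)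
open import Data.Rational.Base as ℚ using (ℚ; 0ℚ)
import Data.Rational.Properties as ℚ
open import Data.Sum.Base using (inj₁; inj₂)
open import Function.Base using (_∘_)
open import Function.Bundles using (module Injection)
open import Function.Properties.Inverse using (Inverse⇒Injection)
open import Level using (0ℓ)
open import Relation.Binary.PropositionalEquality.Core using (_≡_; refl; sym; subst)
open import Relation.Nullary.Decidable using (yes; no)
open import Relation.Unary using (Pred; _∈_)

-- With n the size of `A`, two of the visits numbered 0 to n fall on the same state by pigeonhole;
-- their times differ because visit times strictly increase.
infinitely-often-repeats :
  {A : Set} → FiniteSet A → (B : Pred A 0ℓ) (π : ℕ → A) →
  (∀ n → ∃[ m ] n ℕ.≤ m × π m ∈ B) →
  ∃[ i ] ∃[ j ] 0 ℕ.< i × i ℕ.< j × π i ∈ B × π i ≡ π j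
infinitely-often-repeats (n , A↔Fin) B π often =
  let i , j , i<j , eq = pigeonhole (ℕ.n<1+n n) (to ∘ π ∘ visit ∘ toℕ)
  in visit (toℕ i) , visit (toℕ j) , visit-positive (toℕ i) , visit-mono-< i<j ,
     visit-∈ (toℕ i) , injective eq
  where
  open Injection (Inverse⇒Injection A↔Fin) using (to; injective)

  visit : ℕ → ℕ
  -- Starting from 1 keeps every visit at a positive time, so that a walk from `π 0` to it has at
  -- least one transition even when `π 0` lies in `B`.
  visit zero    = proj₁ (often 1)
  visit (suc k) = proj₁ (often (suc (visit k)))

  visit-∈ : ∀ k → π (visit k) ∈ B
  visit-∈ zero    = proj₂ (proj₂ (often 1))
  visit-∈ (suc k) = proj₂ (proj₂ (often (suc (visit k))))

  visit-step : ∀ k → visit k ℕ.< visit (suc k)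
  visit-step k = proj₁ (proj₂ (often (suc (visit k))))

  visit-positive : ∀ k → 0 ℕ.< visit k
  visit-positive zero    = proj₁ (proj₂ (often 1))
  visit-positive (suc k) = ℕ.<-trans (visit-positive k) (visit-step k)

  visit-mono-< : ∀ {i j} → i ℕ.< j → visit i ℕ.< visit j
  visit-mono-< {i} {suc j} i<1+j with ℕ.m<1+n⇒m<n∨m≡n i<1+j
  ... | inj₁ i<j  = ℕ.<-trans (visit-mono-< i<j) (visit-step j)
  ... | inj₂ refl = visit-step i

module _ (M : PossibilisticKripkeStructure) where

  -- The walk is a stretch of the path itself: shifting the path brings `m` down to 0, then the
  -- states strictly between are collected.
  path-walk : ∀ {p} (π : ℕ → S M) → (∀ i → p ∈ cut (P M (π i) (π (suc i)))) →
              ∀ {m n} → m ℕ.< n → ∃[ us ] p ∈ cut (walk M (π m) us (π n))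
  path-walk π p∈P {zero}  {suc zero}    _         = [] , p∈P 0
  path-walk π p∈P {zero}  {suc (suc n)} _         =
    let us , p∈us = path-walk (π ∘ suc) (p∈P ∘ suc) {0} {suc n} z<s
    in π 1 ∷ us , p∈P 0 , p∈us
  path-walk π p∈P {suc m} {suc n}       (s<s m<n) = path-walk (π ∘ suc) (p∈P ∘ suc) m<n

  module Lasso (a : S M) (vs : List (S M)) where

    -- A state together with the states still to be visited before reaching a.
    Config : Set
    Config = S M × List (S M)

    next : Config → Config
    next (_ , [])     = a , vs
    next (_ , u ∷ us) = u , us

    -- Applying `next` first makes `lasso c (suc i)` definitionally `lasso (next c) i`, so induction
    -- on time can change the configuration.
    run : Config → ℕ → Config
    run c zero    = c
    run c (suc n) = run (next c) n

    lasso : Config → ℕ → S M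
    lasso c n = proj₁ (run c n)

    Above : ℚ → Config → Set
    Above p (x , us) = p ∈ cut (walk M x us a)

    -- `Above p` is invariant under `next`: a step drops the leading factor of the meet, which
    -- bounds the current transition, and `loop` restores the invariant when the list is empty.
    lasso-above : ∀ {p} → Above p (a , vs) → ∀ c → Above p c →
                  ∀ i → p ∈ cut (P M (lasso c i) (lasso c (suc i)))
    lasso-above loop (x , [])     p∈c       zero    = p∈c
    lasso-above loop (x , u ∷ us) (p∈P , _) zero    = p∈P
    lasso-above loop (x , [])     p∈c       (suc i) = lasso-above loop (a , vs) loop i
    lasso-above loop (x , u ∷ us) (_ , p∈w) (suc i) = lasso-above loop (u , us) p∈w i

    lasso-reaches : ∀ x us → ∃[ m ] lasso (x , us) m ≡ a
    -- Not 0, as `x` need not be `a`: with an empty list, `a` is the next state.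
    lasso-reaches x []       = 1 , refl
    lasso-reaches x (u ∷ us) = let m , eq = lasso-reaches u us in suc m , eq

    lasso-recurs : ∀ c n → ∃[ m ] n ℕ.≤ m × lasso c m ≡ a
    lasso-recurs (x , us) zero    = let m , eq = lasso-reaches x us in m , ℕ.z≤n , eq
    lasso-recurs c        (suc n) =
      let m , n≤m , eq = lasso-recurs (next c) n in suc m , ℕ.s≤s n≤m , eq

  module _ (B : Pred (S M) 0ℓ) (s : S M) where

    recurrence : [0,1]
    recurrence = ⋁ {J = Σ (S M) B} (λ (a , _) → P⁺ M s a ∧ P⁺ M a a)

    □◇≤recurrence : Finite M → Po[ M , s ⊨ □◇ M B ] ≤ recurrence
    □◇≤recurrence _ (inj₁ p<0) = inj₁ p<0
    □◇≤recurrence (finS , _) (inj₂ (((π , _) , often , refl) , _ , p∈⋀)) =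
      let i , j , 0<i , i<j , πi∈B , πi≡πj = infinitely-often-repeats finS B π often
          p∈P = λ k → ⋀-lower (λ i → P M (π i) (π (suc i))) k p∈⋀
          -- The stretch from time `i` to time `j` is a closed walk, since the states at both ends
          -- agree.
          loop = subst (λ t → ∃[ us ] _ ∈ cut (walk M (π i) us t)) (sym πi≡πj)
                       (path-walk π p∈P i<j)
      in inj₂ ((π i , πi∈B) , inj₂ (path-walk π p∈P 0<i) , inj₂ loop)

    recurrence≤□◇ : recurrence ≤ Po[ M , s ⊨ □◇ M B ]
    recurrence≤□◇ (inj₁ p<0)                = inj₁ p<0
    recurrence≤□◇ (inj₂ (_ , inj₁ p<0 , _)) = inj₁ p<0
    recurrence≤□◇ (inj₂ (_ , _ , inj₁ p<0)) = inj₁ p<0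
    recurrence≤□◇ {p} (inj₂ ((a , a∈B) , inj₂ (us , p∈us) , inj₂ (vs , p∈vs)))
      -- Negative rationals lie in every cut. Otherwise `p` itself witnesses that each transition of
      -- the lasso is positive, as a path requires.
      with p ℚ.<? 0ℚ
    ... | yes p<0 = inj₁ p<0
    ... | no  p≮0 =
      inj₂ (((π , λ i → p , p≮0 , lasso-above p∈vs (s , us) p∈us i) , often , refl) ,
            𝟏≤dirac M s (upper (walk M s us a) p∈us) , p∈⋀)
      where
      open Lasso a vs

      π : ℕ → S M
      π = lasso (s , us)

      often : ∀ n → ∃[ m ] n ℕ.≤ m × π m ∈ B
      often n = let m , n≤m , eq = lasso-recurs (s , us) n
                in m , n≤m , subst B (sym eq) a∈B

      p∈⋀ : p ∈ cut (⋀ (λ i → P M (π i) (π (suc i))))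
      -- The infimum asks for one rational above `p` common to all transitions; the roundedness of
      -- the meet of the two walks supplies it.
      p∈⋀ = ⋀-greatest (λ i → P M (π i) (π (suc i))) (walk M s us a ∧ walk M a vs a)
              (λ i (q∈us , q∈vs) → lasso-above q∈vs (s , us) q∈us i) (p∈us , p∈vs)

theorem16 : (M : PossibilisticKripkeStructure) → Finite M →
    (B : Pred (S M) 0ℓ) (s : S M) →
    Po[ M , s ⊨ □◇ M B ] ≈ ⋁ {J = Σ (S M) B} (λ (a , _) → P⁺ M s a ∧ P⁺ M a a)
theorem16 M fin B s = □◇≤recurrence M B s fin , recurrence≤□◇ M B s
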